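{- There is no binary linear $[n,k,d]$ code $C$ with $\mathbf{1}_n\in C$ such that, for some positive integer $t$, $$d^\perp-t=\#\{u \mid C_u\neq\emptyset,\ 0<u\le n-t\}=3,$$ the nonzero weights of $C$ are exactly $d,\ n/2,\ n-d,\ n$ (with $n$ even), and $d^\perp>8$.
   Context: $\mathbf{1}_n$ is the all-ones vector; $C^\perp$ is the dual code with respect to the standard inner product and $d^\perp$ its minimum nonzero weight; $C_u=\{c\in C:\mathrm{wt}(c)=u\}$ (Hamming weight). The paper notes that in the case $d^\perp-t=3$ the weight distribution of $C$ is supported on $0,d,n/2,n-d,n$ with $n$ even, and works under this assumption throughout. -}

module Defs where

open import Level using (0ℓ)
open import Data.Bool using (Bool; true; false; _∧_; _xor_; _≟_)
open import Data.Nat using (ℕ; _≤_)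
open import Data.Vec using (Vec; []; _∷_; map; zipWith; replicate; foldr′; count; lookup)
open import Data.Fin using (Fin)
open import Data.List using (length)
open import Data.List.Membership.Propositional using () renaming (_∈_ to _∈ˡ_)
open import Data.List.Relation.Unary.Unique.Propositional using (Unique)
open import Data.Product using (∃-syntax; _×_)
open import Function.Bundles using (_⇔_)
open import Relation.Unary using (Pred; _∈_)
open import Relation.Binary.PropositionalEquality using (_≡_; _≢_)

-- F₂ is Bool with addition _xor_ and multiplication _∧_
-- (Data.Bool.Properties.xor-∧-commutativeRing); Word n is F₂ⁿ.
Word : ℕ → Set
Word n = Vec Bool n

infixl 6 _⊕_
infixr 7 _·_

𝟎 : ∀ n → Word n
𝟎 n = replicate n false

𝟏 : ∀ n → Word n
𝟏 n = replicate n true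

_⊕_ : ∀ {n} → Word n → Word n → Word n
_⊕_ = zipWith _xor_

_·_ : ∀ {n} → Bool → Word n → Word n
a · x = map (a ∧_) x

⟪_,_⟫ : ∀ {n} → Word n → Word n → Bool
⟪ x , y ⟫ = foldr′ _xor_ false (zipWith _∧_ x y)

wt : ∀ {n} → Word n → ℕ
wt = count (_≟ true)

Code : ℕ → Set₁
Code n = Pred (Word n) 0ℓ

record IsSubspace {n} (C : Code n) : Set where
  field
    𝟎-mem    : 𝟎 n ∈ C
    ⊕-closed : ∀ {x y} → x ∈ C → y ∈ C → x ⊕ y ∈ C
    ·-closed : ∀ a {x} → x ∈ C → a · x ∈ C

lincomb : ∀ {n k} → Vec Bool k → Vec (Word n) k → Word n
lincomb {n} []       []       = 𝟎 n
lincomb     (a ∷ as) (b ∷ bs) = a · b ⊕ lincomb as bs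

record IsBasis {n k} (C : Code n) (b : Vec (Word n) k) : Set where
  field
    members     : ∀ (i : Fin k) → lookup b i ∈ C
    spanning    : ∀ {x} → x ∈ C → ∃[ a ] lincomb a b ≡ x
    independent : ∀ a → lincomb a b ≡ 𝟎 n → a ≡ replicate k false

-- Attained by a nonzero word, so no d satisfies this for the zero code.
IsMinWeight : ∀ {n} → Code n → ℕ → Set
IsMinWeight {n} C d =
  (∃[ c ] (c ∈ C × c ≢ 𝟎 n × wt c ≡ d)) ×
  (∀ c → c ∈ C → c ≢ 𝟎 n → d ≤ wt c)

-- For a linear code the minimum distance is the minimum nonzero weight.
record IsLinearCode (n k d : ℕ) (C : Code n) : Set where
  field
    isSubspace  : IsSubspace C
    basis       : Vec (Word n) k
    isBasis     : IsBasis C basis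
    isMinWeight : IsMinWeight C d

infix 8 _^⊥

_^⊥ : ∀ {n} → Code n → Code n
(C ^⊥) y = ∀ x → x ∈ C → ⟪ x , y ⟫ ≡ false

_⟨_⟩ : ∀ {n} → Code n → ℕ → Code n
(C ⟨ u ⟩) c = c ∈ C × wt c ≡ u

-- # P ≡ m for a set P of naturals: P is listed without repetition by a list
-- of length m.
HasSize : Pred ℕ 0ℓ → ℕ → Set
HasSize P m = ∃[ us ] (Unique us × length us ≡ m × (∀ u → u ∈ˡ us ⇔ P u))

{-# OPTIONS --safe #-}

-- Put x(c) = n − 2 wt(c) and χ_w(c) = (−1)^⟨c,w⟩, and fix a word w of weight 5.
-- Multiplying χ_w by x gives the sum of the χ_w′ over the words w′ obtained from
-- w by flipping one bit, so for j ≤ 3 the function χ_w x^j is a sum of characters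
-- χ_v with 2 ≤ wt(v) ≤ 8.  As d^⊥ > 8 no such v is in the dual code, hence χ_w x^j
-- sums to 0 over C.  Thus the sum of χ_w x (x² − (n − 2d)²) over C vanishes.  But
-- its terms vanish at the words of weight d, n/2 and n − d, and are positive at
-- the zero word and at the all-ones word (x and χ_w both change sign there,
-- since wt(w) is odd).
module Submission where

open import Defs
open import Data.Nat using (ℕ; _<_; _≤_; _∸_; _/_)
open import Data.Nat.Divisibility using (_∣_)
open import Data.List using ([]; _∷_)
open import Data.List.Membership.Propositional using () renaming (_∈_ to _∈ˡ_)
open import Data.Product using (_×_)
open import Function.Bundles using (_⇔_)
open import Relation.Nullary using (¬_)
open import Relation.Unary using (_∈_; Satisfiable)
open import Relation.Binary.PropositionalEquality using (_≡_)

open import Algebra.Bundles using (CommutativeRing)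
open import Data.Bool using (Bool; true; false; not; _∧_; _xor_)
open import Data.Bool.Properties using (xor-assoc; ∧-distribʳ-xor; xor-∧-commutativeRing)
open import Data.Empty using (⊥-elim)
open import Data.Fin using (Fin; zero; suc)
open import Data.Integer using (ℤ; +_; _+_; _*_; _^_; _-_; -_; 0ℤ; 1ℤ; -1ℤ)
import Data.Integer as ℤ
import Data.Integer.Properties as ℤ
open import Algebra.Properties.Semiring.Sum ℤ.+-*-semiring using (sum; *-distribˡ-sum; sum-cong-≋)
open import Data.Integer.Tactic.RingSolver using (solve-∀)
open import Data.List.Relation.Unary.Any using (here; there)
open import Data.Nat using (zero; suc; z≤n; s≤s; z<s; s<s)
import Data.Nat as ℕ
open import Data.Nat.DivMod using (m*[n/m]≡n)
open import Data.Nat.GeneralisedArithmetic using (fold)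
import Data.Nat.Properties as ℕ
open import Data.Product using (∃; _,_; proj₁; proj₂)
open import Data.Sum using (_⊎_; inj₁; inj₂)
open import Data.Vec using (Vec; []; _∷_; lookup; updateAt)
open import Data.Vec.Properties using (count≤n)
open import Function using (_∘_)
open import Function.Bundles using (Equivalence)
open import Relation.Binary.PropositionalEquality
  using (refl; sym; trans; cong; cong₂; subst; _≢_; module ≡-Reasoning)

private
  variable
    n k : ℕ

-- Integer sums over F₂ᵏ.

∑ : ∀ {k} → (Vec Bool k → ℤ) → ℤ
∑ {zero}  f = f []
∑ {suc k} f = ∑ (f ∘ (false ∷_)) + ∑ (f ∘ (true ∷_))

∑-cong : {f g : Vec Bool k → ℤ} → (∀ a → f a ≡ g a) → ∑ f ≡ ∑ g
∑-cong {k = zero}  f≗g = f≗g []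
∑-cong {k = suc k} f≗g =
  cong₂ _+_ (∑-cong (f≗g ∘ (false ∷_))) (∑-cong (f≗g ∘ (true ∷_)))

∑-zero : ∑ {k} (λ _ → 0ℤ) ≡ 0ℤ
∑-zero {zero}  = refl
∑-zero {suc k} = cong₂ _+_ (∑-zero {k}) (∑-zero {k})

∑-distrib-+ : (f g : Vec Bool k → ℤ) → ∑ (λ a → f a + g a) ≡ ∑ f + ∑ g
∑-distrib-+ {k = zero}  f g = refl
∑-distrib-+ {k = suc k} f g =
  trans (cong₂ _+_ (∑-distrib-+ (f ∘ (false ∷_)) _) (∑-distrib-+ (f ∘ (true ∷_)) _))
        (interchange (∑ (f ∘ (false ∷_))) (∑ (g ∘ (false ∷_))) (∑ (f ∘ (true ∷_))) (∑ (g ∘ (true ∷_))))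
  where
  interchange : ∀ p q r s → (p + q) + (r + s) ≡ (p + r) + (q + s)
  interchange = solve-∀

*-distribˡ-∑ : ∀ x (f : Vec Bool k → ℤ) → x * ∑ f ≡ ∑ (λ a → x * f a)
*-distribˡ-∑ {k = zero}  x f = refl
*-distribˡ-∑ {k = suc k} x f =
  trans (ℤ.*-distribˡ-+ x _ _)
        (cong₂ _+_ (*-distribˡ-∑ x (f ∘ (false ∷_))) (*-distribˡ-∑ x (f ∘ (true ∷_))))

-- Interchange of the two summations, by induction on `m`.
∑-sum≡0 : ∀ {m} (f : Fin m → Vec Bool k → ℤ) →
          (∀ i → ∑ (f i) ≡ 0ℤ) → ∑ (λ a → sum (λ i → f i a)) ≡ 0ℤ
∑-sum≡0 {k = k} {m = zero}  f ∑f≡0 = ∑-zero {k}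
∑-sum≡0         {m = suc m} f ∑f≡0 =
  trans (∑-distrib-+ (f zero) _) (cong₂ _+_ (∑f≡0 zero) (∑-sum≡0 (f ∘ suc) (∑f≡0 ∘ suc)))

∑-nonneg : (f : Vec Bool k → ℤ) → (∀ a → 0ℤ ℤ.≤ f a) → 0ℤ ℤ.≤ ∑ f
∑-nonneg {k = zero}  f 0≤f = 0≤f []
∑-nonneg {k = suc k} f 0≤f =
  ℤ.+-mono-≤ (∑-nonneg _ (0≤f ∘ (false ∷_))) (∑-nonneg _ (0≤f ∘ (true ∷_)))

-- The remaining terms only add to the sum. Hence one positive term keeps such a sum from vanishing.
term≤∑ : (f : Vec Bool k → ℤ) → (∀ a → 0ℤ ℤ.≤ f a) → ∀ a → f a ℤ.≤ ∑ f
term≤∑ f 0≤f [] = ℤ.≤-refl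
term≤∑ f 0≤f (false ∷ a) = subst (ℤ._≤ ∑ f) (ℤ.+-identityʳ _)
  (ℤ.+-mono-≤ (term≤∑ _ (0≤f ∘ (false ∷_)) a) (∑-nonneg _ (0≤f ∘ (true ∷_))))
term≤∑ f 0≤f (true ∷ a) = subst (ℤ._≤ ∑ f) (ℤ.+-identityˡ _)
  (ℤ.+-mono-≤ (∑-nonneg _ (0≤f ∘ (false ∷_))) (term≤∑ _ (0≤f ∘ (true ∷_)) a))

-- Inner products, weights and bit flips.

⟪⟫-⊕ : (x y w : Word n) → ⟪ x ⊕ y , w ⟫ ≡ ⟪ x , w ⟫ xor ⟪ y , w ⟫
⟪⟫-⊕ []      []      []      = refl
⟪⟫-⊕ (a ∷ x) (b ∷ y) (c ∷ w) = begin
  ((a xor b) ∧ c) xor ⟪ x ⊕ y , w ⟫                    ≡⟨ cong₂ _xor_ (∧-distribʳ-xor c a b) (⟪⟫-⊕ x y w) ⟩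
  ((a ∧ c) xor (b ∧ c)) xor (⟪ x , w ⟫ xor ⟪ y , w ⟫)  ≡⟨ interchange (a ∧ c) (b ∧ c) _ _ ⟩
  ((a ∧ c) xor ⟪ x , w ⟫) xor ((b ∧ c) xor ⟪ y , w ⟫)  ∎
  where
  open ≡-Reasoning
  open import Algebra.Properties.CommutativeSemigroup
    (CommutativeRing.+-commutativeSemigroup xor-∧-commutativeRing)

⟪⟫-· : ∀ a (x w : Word n) → ⟪ a · x , w ⟫ ≡ a ∧ ⟪ x , w ⟫
⟪⟫-· true  []      []      = refl
⟪⟫-· false []      []      = refl
⟪⟫-· true  (b ∷ x) (c ∷ w) = cong ((b ∧ c) xor_) (⟪⟫-· true x w)
⟪⟫-· false (b ∷ x) (c ∷ w) = ⟪⟫-· false x w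

⟪⟫-𝟎 : (w : Word n) → ⟪ 𝟎 n , w ⟫ ≡ false
⟪⟫-𝟎 []      = refl
⟪⟫-𝟎 (b ∷ w) = ⟪⟫-𝟎 w

-- `fold false not` is parity, in a form that evaluates once the weight is a numeral.
⟪⟫-𝟏 : (w : Word n) → ⟪ 𝟏 n , w ⟫ ≡ fold false not (wt w)
⟪⟫-𝟏 []          = refl
⟪⟫-𝟏 (true  ∷ w) = cong not (⟪⟫-𝟏 w)
⟪⟫-𝟏 (false ∷ w) = ⟪⟫-𝟏 w

wt-𝟎 : ∀ n → wt (𝟎 n) ≡ 0
wt-𝟎 zero    = refl
wt-𝟎 (suc n) = wt-𝟎 n

wt≡0⇒≡𝟎 : (x : Word n) → wt x ≡ 0 → x ≡ 𝟎 n
wt≡0⇒≡𝟎 []          _ = refl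
wt≡0⇒≡𝟎 (false ∷ x) p = cong (false ∷_) (wt≡0⇒≡𝟎 x p)

wt≤n : (x : Word n) → wt x ≤ n
wt≤n = count≤n _

wt≡n⇒≡𝟏 : (x : Word n) → wt x ≡ n → x ≡ 𝟏 n
wt≡n⇒≡𝟏 []          _ = refl
wt≡n⇒≡𝟏 (true  ∷ x) p = cong (true ∷_) (wt≡n⇒≡𝟏 x (ℕ.suc-injective p))
wt≡n⇒≡𝟏 (false ∷ x) p = ⊥-elim (ℕ.<-irrefl p (s≤s (wt≤n x)))

∃-wt : ∀ {m n} → m ≤ n → ∃ λ (w : Word n) → wt w ≡ m
∃-wt {n = n} z≤n       = 𝟎 n , wt-𝟎 n
∃-wt         (s≤s m≤n) = let w , p = ∃-wt m≤n in true ∷ w , cong suc p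

flip : Word n → Fin n → Word n
flip w i = updateAt w i not

-- This bound keeps flipped words below the dual distance; its counterpart `wt-flip-≥` keeps them
-- nonzero.
wt-flip-≤ : (w : Word n) (i : Fin n) → wt (flip w i) ≤ suc (wt w)
wt-flip-≤ (true  ∷ w) zero    = ℕ.m≤n⇒m≤1+n (ℕ.n≤1+n _)
wt-flip-≤ (false ∷ w) zero    = ℕ.≤-refl
wt-flip-≤ (true  ∷ w) (suc i) = s≤s (wt-flip-≤ w i)
wt-flip-≤ (false ∷ w) (suc i) = wt-flip-≤ w i

wt-flip-≥ : (w : Word n) (i : Fin n) → wt w ≤ suc (wt (flip w i))
wt-flip-≥ (true  ∷ w) zero    = ℕ.≤-refl
wt-flip-≥ (false ∷ w) zero    = ℕ.m≤n⇒m≤1+n (ℕ.n≤1+n _)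
wt-flip-≥ (true  ∷ w) (suc i) = s≤s (wt-flip-≥ w i)
wt-flip-≥ (false ∷ w) (suc i) = wt-flip-≥ w i

-- A flip adds the `i`-th unit vector to `w`, and its inner product with `x` is the `i`-th bit of
-- `x`.
⟪⟫-flip : (x w : Word n) (i : Fin n) → ⟪ x , flip w i ⟫ ≡ ⟪ x , w ⟫ xor lookup x i
⟪⟫-flip (a ∷ x) (b ∷ w) zero    = head a b _
  where
  head : ∀ a b r → (a ∧ not b) xor r ≡ ((a ∧ b) xor r) xor a
  head true  true  true  = refl
  head true  true  false = refl
  head true  false true  = refl
  head true  false false = refl
  head false b     true  = refl
  head false b     false = refl
⟪⟫-flip (a ∷ x) (b ∷ w) (suc i) =
  trans (cong ((a ∧ b) xor_) (⟪⟫-flip x w i)) (sym (xor-assoc (a ∧ b) _ _))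

-- Characters of F₂ⁿ and their sums over a span.

χ : Bool → ℤ
χ false = 1ℤ
χ true  = -1ℤ

χ-xor : ∀ a b → χ (a xor b) ≡ χ a * χ b
χ-xor false b     = sym (ℤ.*-identityˡ (χ b))
χ-xor true  false = refl
χ-xor true  true  = refl

-- The first Krawtchouk polynomial `n - 2 wt x`, written as a sum of unit-vector characters so that
-- a product with a character expands termwise.
bias : Word n → ℤ
bias x = sum (λ i → χ (lookup x i))

bias-wt : (x : Word n) → bias x ≡ + n - + 2 * + wt x
bias-wt []                    = refl
bias-wt {n = suc n} (true ∷ x)  = trans (cong (λ y → -1ℤ + y) (bias-wt x)) (step (+ n) (+ wt x))
  where
  step : ∀ p q → -1ℤ + (p - + 2 * q) ≡ (1ℤ + p) - + 2 * (1ℤ + q)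
  step = solve-∀
bias-wt {n = suc n} (false ∷ x) = trans (cong (λ y → 1ℤ + y) (bias-wt x)) (step (+ n) (+ wt x))
  where
  step : ∀ p q → 1ℤ + (p - + 2 * q) ≡ (1ℤ + p) - + 2 * q
  step = solve-∀

χ*bias : (x w : Word n) → χ ⟪ x , w ⟫ * bias x ≡ sum (λ i → χ ⟪ x , flip w i ⟫)
χ*bias x w = trans (*-distribˡ-sum (χ ⟪ x , w ⟫) (χ ∘ lookup x))
                   (sum-cong-≋ (λ i → trans (sym (χ-xor ⟪ x , w ⟫ _)) (cong χ (sym (⟪⟫-flip x w i)))))

⟪⟫-lincomb : ∀ a (as : Vec Bool k) b (bs : Vec (Word n) k) w →
             ⟪ lincomb (a ∷ as) (b ∷ bs) , w ⟫ ≡ (a ∧ ⟪ b , w ⟫) xor ⟪ lincomb as bs , w ⟫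
⟪⟫-lincomb a as b bs w = trans (⟪⟫-⊕ (a · b) _ w) (cong (_xor _) (⟪⟫-· a b w))

-- Orthogonality of characters, by induction on the generators: a character that is nontrivial on
-- one of them cancels in pairs.
character-sum : (bs : Vec (Word n) k) (w : Word n) →
  (∀ as → ⟪ lincomb as bs , w ⟫ ≡ false) ⊎ ∑ (λ as → χ ⟪ lincomb as bs , w ⟫) ≡ 0ℤ
character-sum {n} [] w = inj₁ λ { [] → ⟪⟫-𝟎 w }
character-sum {k = suc k} (b ∷ bs) w with ⟪ b , w ⟫ in eq | character-sum bs w
... | false | inj₁ trivial = inj₁ λ where
        (false ∷ as) → trans (⟪⟫-lincomb false as b bs w) (trivial as)
        (true  ∷ as) → trans (⟪⟫-lincomb true as b bs w) (cong₂ _xor_ eq (trivial as))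
-- Whatever the sign at `b`, each half is a multiple of the vanishing sum over the tail.
... | r     | inj₂ ∑≡0 = inj₂ (cong₂ _+_ (half false) (half true))
  where
  half : ∀ a → ∑ (λ as → χ ⟪ lincomb (a ∷ as) (b ∷ bs) , w ⟫) ≡ 0ℤ
  half a = begin
    ∑ (λ as → χ ⟪ lincomb (a ∷ as) (b ∷ bs) , w ⟫)
      ≡⟨ ∑-cong {k = k} (λ as → trans (cong χ (⟪⟫-lincomb a as b bs w)) (χ-xor (a ∧ ⟪ b , w ⟫) _)) ⟩
    ∑ (λ as → χ (a ∧ ⟪ b , w ⟫) * χ ⟪ lincomb as bs , w ⟫)
      ≡⟨ sym (*-distribˡ-∑ (χ (a ∧ ⟪ b , w ⟫)) (λ as → χ ⟪ lincomb as bs , w ⟫)) ⟩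
    χ (a ∧ ⟪ b , w ⟫) * ∑ (λ as → χ ⟪ lincomb as bs , w ⟫)
      ≡⟨ cong (χ (a ∧ ⟪ b , w ⟫) *_) ∑≡0 ⟩
    χ (a ∧ ⟪ b , w ⟫) * 0ℤ
      ≡⟨ ℤ.*-zeroʳ (χ (a ∧ ⟪ b , w ⟫)) ⟩
    0ℤ ∎
    where open ≡-Reasoning
-- The character is 1 on the span of `bs` and -1 on its translate by `b`, so the halves cancel
-- termwise.
... | true  | inj₁ trivial = inj₂ (begin
    ∑ (λ as → χ ⟪ lincomb (false ∷ as) (b ∷ bs) , w ⟫) + ∑ (λ as → χ ⟪ lincomb (true ∷ as) (b ∷ bs) , w ⟫)
      ≡⟨ sym (∑-distrib-+ (λ as → χ ⟪ lincomb (false ∷ as) (b ∷ bs) , w ⟫) _) ⟩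
    ∑ (λ as → χ ⟪ lincomb (false ∷ as) (b ∷ bs) , w ⟫ + χ ⟪ lincomb (true ∷ as) (b ∷ bs) , w ⟫)
      ≡⟨ ∑-cong {k = k} (λ as → cong₂ _+_
           (cong χ (trans (⟪⟫-lincomb false as b bs w) (trivial as)))
           (cong χ (trans (⟪⟫-lincomb true as b bs w) (cong₂ _xor_ eq (trivial as))))) ⟩
    ∑ {k} (λ _ → 0ℤ)
      ≡⟨ ∑-zero {k} ⟩
    0ℤ ∎)
  where open ≡-Reasoning

-- Vanishing moments below the dual distance.

module _ {n k e} (C : Code n) (bs : Vec (Word n) k)
         (spanning : ∀ {x} → x ∈ C → ∃ λ as → lincomb as bs ≡ x)
         (dual-min : ∀ c → c ∈ (C ^⊥) → c ≢ 𝟎 n → e ≤ wt c) where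

  -- Each factor `bias` trades the character of `w` for those of its one-bit flips. The two bounds
  -- keep the weight positive and below `e` through `j` flips, and both survive a flip that lowers
  -- `j` by one.
  moment≡0 : ∀ j w → j < wt w → wt w ℕ.+ j < e →
             ∑ (λ as → χ ⟪ lincomb as bs , w ⟫ * bias (lincomb as bs) ^ j) ≡ 0ℤ
  moment≡0 zero w 0<wt wt<e with character-sum bs w
  ... | inj₂ ∑≡0     = trans (∑-cong {k = k} (λ as → ℤ.*-identityʳ (χ ⟪ lincomb as bs , w ⟫))) ∑≡0
  -- A trivial character would make `w` a nonzero dual word of weight below `e`.
  ... | inj₁ trivial = ⊥-elim (ℕ.<⇒≱ wt<e (ℕ.≤-trans (dual-min w w∈C⊥ w≢𝟎) (ℕ.m≤m+n _ 0)))
    where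
    w∈C⊥ : w ∈ (C ^⊥)
    w∈C⊥ x x∈C = let as , eq = spanning x∈C in subst (λ y → ⟪ y , w ⟫ ≡ false) eq (trivial as)

    w≢𝟎 : w ≢ 𝟎 n
    w≢𝟎 refl = ℕ.<-irrefl (sym (wt-𝟎 n)) 0<wt
  moment≡0 (suc j) w j<wt wt<e = begin
    ∑ (λ as → χ ⟪ c as , w ⟫ * (bias (c as) * bias (c as) ^ j))
      ≡⟨ ∑-cong {k = k} (λ as → trans
           (rearrange (χ ⟪ c as , w ⟫) (bias (c as)) (bias (c as) ^ j))
           (cong (bias (c as) ^ j *_) (χ*bias (c as) w))) ⟩
    ∑ (λ as → bias (c as) ^ j * sum (λ i → χ ⟪ c as , flip w i ⟫))
      ≡⟨ ∑-cong {k = k} (λ as → *-distribˡ-sum (bias (c as) ^ j) (λ i → χ ⟪ c as , flip w i ⟫)) ⟩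
    ∑ (λ as → sum (λ i → bias (c as) ^ j * χ ⟪ c as , flip w i ⟫))
      ≡⟨ ∑-sum≡0 (λ i as → bias (c as) ^ j * χ ⟪ c as , flip w i ⟫) (λ i → trans
           (∑-cong {k = k} (λ as → ℤ.*-comm (bias (c as) ^ j) (χ ⟪ c as , flip w i ⟫)))
           (moment≡0 j (flip w i)
           (ℕ.≤-pred (ℕ.<-≤-trans j<wt (wt-flip-≥ w i)))
           (ℕ.≤-<-trans (ℕ.+-monoˡ-≤ j (wt-flip-≤ w i)) (subst (_< e) (ℕ.+-suc _ j) wt<e)))) ⟩
    0ℤ ∎
    where
    open ≡-Reasoning

    c : Vec Bool k → Word n
    c as = lincomb as bs

    rearrange : ∀ p q r → p * (q * r) ≡ r * (p * q)
    rearrange = solve-∀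

  -- Only the third and first moments occur, and the bounds for the third imply those for the first.
  cubic-sum≡0 : ∀ s w → 3 < wt w → wt w ℕ.+ 3 < e →
    ∑ (λ as → let x = bias (lincomb as bs) in χ ⟪ lincomb as bs , w ⟫ * (x * (x * x - s))) ≡ 0ℤ
  cubic-sum≡0 s w 3<wt wt<e = begin
    ∑ (λ as → χ ⟪ c as , w ⟫ * (bias (c as) * (bias (c as) * bias (c as) - s)))
      ≡⟨ ∑-cong {k = k} (λ as → expand (χ ⟪ c as , w ⟫) (bias (c as)) s) ⟩
    ∑ (λ as → χ ⟪ c as , w ⟫ * bias (c as) ^ 3 + - s * (χ ⟪ c as , w ⟫ * bias (c as) ^ 1))
      ≡⟨ ∑-distrib-+ (λ as → χ ⟪ c as , w ⟫ * bias (c as) ^ 3) _ ⟩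
    ∑ (λ as → χ ⟪ c as , w ⟫ * bias (c as) ^ 3) + ∑ (λ as → - s * (χ ⟪ c as , w ⟫ * bias (c as) ^ 1))
      ≡⟨ cong₂ _+_ (moment≡0 3 w 3<wt wt<e) (trans (sym (*-distribˡ-∑ (- s) (λ as → χ ⟪ c as , w ⟫ * bias (c as) ^ 1)))
           (cong (- s *_) (moment≡0 1 w (ℕ.<-trans (s<s z<s) 3<wt)
             (ℕ.≤-<-trans (ℕ.+-monoʳ-≤ (wt w) (s≤s z≤n)) wt<e)))) ⟩
    0ℤ + - s * 0ℤ
      ≡⟨ trans (ℤ.+-identityˡ _) (ℤ.*-zeroʳ (- s)) ⟩
    0ℤ ∎
    where
    open ≡-Reasoning

    c : Vec Bool k → Word n
    c as = lincomb as bs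

    expand : ∀ p x s → p * (x * (x * x - s)) ≡ p * (x * (x * (x * 1ℤ))) + - s * (p * (x * 1ℤ))
    expand = solve-∀

-- Contradiction from a cubic with roots at the middle weights.

theorem4p2 : ∀ (n k d d⊥ t : ℕ) (C : Code n) →
    ¬ ( IsLinearCode n k d C
    × 𝟏 n ∈ C
    × IsMinWeight (C ^⊥) d⊥
    × 0 < t
    × d⊥ ∸ t ≡ 3
    × HasSize (λ u → ∃⟨ C ⟨ u ⟩ ⟩ × 0 < u × u ≤ n ∸ t) 3
    × 2 ∣ n
    × (∀ u → (0 < u × ∃⟨ C ⟨ u ⟩ ⟩) ⇔ (u ∈ˡ d ∷ n / 2 ∷ n ∸ d ∷ n ∷ []))
    × 8 < d⊥ )
theorem4p2 n k d d⊥ t C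
  (linear , _ , ((v , _ , _ , wt-v) , dual-min) , _ , _ , _ , 2∣n , weights , 8<d⊥) =
  ℤ.<⇒≱ 0<term (subst (term 𝟎-coeffs ℤ.≤_) ∑term≡0 (term≤∑ term term-nonneg 𝟎-coeffs))
  where
  open IsLinearCode linear
  open IsSubspace isSubspace
  open IsBasis isBasis

  e : ℕ
  e = n ∸ d

  0<d : 0 < d
  0<d = proj₁ (Equivalence.from (weights d) (here refl))

  0<e : 0 < e
  0<e = proj₁ (Equivalence.from (weights e) (there (there (here refl))))

  -- Positivity of `e` shows that the truncated subtraction is a genuine one.
  n≡d+e : n ≡ d ℕ.+ e
  n≡d+e = sym (ℕ.m+[n∸m]≡n (ℕ.<⇒≤ (ℕ.m∸n≢0⇒n<m {n} {d} (ℕ.m<n⇒n≢0 {n = e} 0<e))))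

  -- A dual word of weight `d⊥`, which exceeds 8, fits into length `n`.
  5≤n : 5 ≤ n
  5≤n = ℕ.≤-trans (s≤s (s≤s (s≤s (s≤s (s≤s z≤n))))) (ℕ.≤-trans 8<d⊥ (subst (_≤ n) wt-v (wt≤n v)))

  -- 5 is the least odd number above 3, and `5 + 3` is still below `d⊥`.
  w : Word n
  w = proj₁ (∃-wt 5≤n)

  wt-w : wt w ≡ 5
  wt-w = proj₂ (∃-wt 5≤n)

  -- With `n` written as `D + E`, the bias at weight `d` is `E - D`, and the evaluations below
  -- become polynomial identities.
  D E s : ℤ
  D = + d
  E = + e
  s = (E - D) * (E - D)

  -- Its roots 0 and `±(E - D)` are the biases at the weights `n / 2`, `d` and `e`.
  cubic : ℤ → ℤ
  cubic x = x * (x * x - s)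

  value : Word n → ℤ
  value c = χ ⟪ c , w ⟫ * cubic (bias c)

  -- This is `cubic (D + E)` in factored form, kept in ℕ so that its sign is immediate.
  peak : ℕ
  peak = d ℕ.* (e ℕ.* (4 ℕ.* (d ℕ.+ e)))

  -- `C` is only a predicate, so its words are enumerated by their coefficients in the basis.
  term : Vec Bool k → ℤ
  term as = value (lincomb as basis)

  bias≡ : ∀ {c u} → wt c ≡ u → bias c ≡ D + E - + 2 * + u
  bias≡ {c} refl = trans (bias-wt c) (cong (λ m → + m - + 2 * + wt c) n≡d+e)

  bias-𝟎 : bias (𝟎 n) ≡ D + E
  bias-𝟎 = trans (bias≡ {𝟎 n} (wt-𝟎 n)) (ℤ.+-identityʳ (D + E))

  +peak≡ : + peak ≡ D * (E * (+ 4 * (D + E)))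
  +peak≡ = trans (ℤ.pos-* d _) (cong (D *_) (trans (ℤ.pos-* e _) (cong (E *_) (ℤ.pos-* 4 (d ℕ.+ e)))))

  value-𝟎 : value (𝟎 n) ≡ + peak
  value-𝟎 = trans (cong₂ (λ b x → χ b * cubic x) (⟪⟫-𝟎 w) bias-𝟎) (trans (at-sum D E) (sym +peak≡))
    where
    at-sum : ∀ D E → let x = D + E in
             1ℤ * (x * (x * x - (E - D) * (E - D))) ≡ D * (E * (+ 4 * (D + E)))
    at-sum = solve-∀

  -- The bias is `- (D + E)`; the sign of the odd cubic is undone by the odd weight of `w`.
  value-n : ∀ c → wt c ≡ n → value c ≡ + peak
  value-n c wt≡n = trans
    (cong₂ (λ b x → χ b * cubic x)
      (trans (cong (λ x → ⟪ x , w ⟫) (wt≡n⇒≡𝟏 c wt≡n)) (trans (⟪⟫-𝟏 w) (cong (fold false not) wt-w)))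
      (bias≡ {c} (trans wt≡n n≡d+e)))
    (trans (at-sum D E) (sym +peak≡))
    where
    at-sum : ∀ D E → let x = D + E - + 2 * (D + E) in
             -1ℤ * (x * (x * x - (E - D) * (E - D))) ≡ D * (E * (+ 4 * (D + E)))
    at-sum = solve-∀

  root⇒value≡0 : ∀ c → cubic (bias c) ≡ 0ℤ → value c ≡ 0ℤ
  root⇒value≡0 c root = trans (cong (χ ⟪ c , w ⟫ *_) root) (ℤ.*-zeroʳ (χ ⟪ c , w ⟫))

  value-d : ∀ c → wt c ≡ d → value c ≡ 0ℤ
  value-d c wt≡d = root⇒value≡0 c (trans (cong cubic (bias≡ {c} wt≡d)) (root D E))
    where
    root : ∀ D E → let x = D + E - + 2 * D in x * (x * x - (E - D) * (E - D)) ≡ 0ℤ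
    root = solve-∀

  value-e : ∀ c → wt c ≡ e → value c ≡ 0ℤ
  value-e c wt≡e = root⇒value≡0 c (trans (cong cubic (bias≡ {c} wt≡e)) (root D E))
    where
    root : ∀ D E → let x = D + E - + 2 * E in x * (x * x - (E - D) * (E - D)) ≡ 0ℤ
    root = solve-∀

  value-n/2 : ∀ c → wt c ≡ n / 2 → value c ≡ 0ℤ
  value-n/2 c wt≡n/2 = root⇒value≡0 c (cong (λ x → x * (x * x - s)) bias≡0)
    where
    bias≡0 : bias c ≡ 0ℤ
    bias≡0 = begin
      bias c                   ≡⟨ bias-wt c ⟩
      + n - + 2 * + wt c       ≡⟨ cong (λ u → + n - + 2 * + u) wt≡n/2 ⟩
      + n - + 2 * + (n / 2)    ≡⟨ cong (λ m → + n - m) (sym (ℤ.pos-* 2 (n / 2))) ⟩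
      -- Evenness of `n` makes the halving exact.
      + n - + (2 ℕ.* (n / 2))  ≡⟨ cong (λ m → + n - + m) (m*[n/m]≡n 2∣n) ⟩
      + n - + n                ≡⟨ ℤ.+-inverseʳ (+ n) ⟩
      0ℤ                       ∎
      where open ≡-Reasoning

  value-nonneg : ∀ c → c ∈ C → 0ℤ ℤ.≤ value c
  -- The list of weights covers positive weights only, so the zero word is split off first.
  value-nonneg c c∈C with ℕ.m≤n⇒m<n∨m≡n (z≤n {wt c})
  ... | inj₂ 0≡wt = subst (0ℤ ℤ.≤_)
        (sym (trans (cong value (wt≡0⇒≡𝟎 c (sym 0≡wt))) value-𝟎)) (ℤ.+≤+ z≤n)
  ... | inj₁ 0<wt with Equivalence.to (weights (wt c)) (0<wt , c , c∈C , refl)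
  ...   | here wt≡d                        = ℤ.≤-reflexive (sym (value-d c wt≡d))
  ...   | there (here wt≡n/2)              = ℤ.≤-reflexive (sym (value-n/2 c wt≡n/2))
  ...   | there (there (here wt≡e))        = ℤ.≤-reflexive (sym (value-e c wt≡e))
  ...   | there (there (there (here wt≡n))) = subst (0ℤ ℤ.≤_) (sym (value-n c wt≡n)) (ℤ.+≤+ z≤n)

  lincomb∈C : ∀ {k} (as : Vec Bool k) (bs : Vec (Word n) k) → (∀ i → lookup bs i ∈ C) → lincomb as bs ∈ C
  lincomb∈C []       []       bs∈C = 𝟎-mem
  lincomb∈C (a ∷ as) (b ∷ bs) bs∈C =
    ⊕-closed (·-closed a (bs∈C zero)) (lincomb∈C as bs (bs∈C ∘ suc))

  term-nonneg : ∀ as → 0ℤ ℤ.≤ term as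
  term-nonneg as = value-nonneg _ (lincomb∈C as basis members)

  ∑term≡0 : ∑ term ≡ 0ℤ
  ∑term≡0 = cubic-sum≡0 C basis spanning dual-min s w
    (subst (3 <_) (sym wt-w) (ℕ.<-trans (ℕ.n<1+n 3) (ℕ.n<1+n 4)))
    -- `5 + 3` evaluates to 8, so this is exactly the bound on `d⊥`.
    (subst (λ u → u ℕ.+ 3 < d⊥) (sym wt-w) 8<d⊥)

  𝟎-coeffs : Vec Bool k
  𝟎-coeffs = proj₁ (spanning 𝟎-mem)

  0<term : 0ℤ ℤ.< term 𝟎-coeffs
  0<term = subst (0ℤ ℤ.<_) (sym (trans (cong value (proj₂ (spanning 𝟎-mem))) value-𝟎)) (ℤ.+<+ 0<peak)
    where
    0<peak : 0 < peak
    0<peak = ℕ.*-mono-< 0<d (ℕ.*-mono-< 0<e (ℕ.*-mono-< {0} {4} (s≤s z≤n) (ℕ.<-≤-trans 0<d (ℕ.m≤m+n d e))))
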